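{- Let $R:\{0,1\}^n\times\{0,1\}^m\to[0,1]$ be a randomized $q$-query algorithm and consider its mean function $\mu_R(x):=\mathbb{E}_{r}[R(x,r)]$, where $r\sim\{0,1\}^m$ is uniform. There is a variable $i\in[n]$ such that $$\mathrm{Inf}_i(\mu_R):=\mathop{\mathbb{E}}_{x}\big[|\mu_R(x)-\mu_R(x^{\oplus i})|\big]\ \ge\ \frac{\mathrm{Var}(\mu_R)}{q},$$ where $x\sim\{0,1\}^n$ is uniform, $\mathrm{Var}(\mu_R)$ is the variance of $\mu_R(x)$, and $x^{\oplus i}$ denotes $x$ with its $i$-th coordinate flipped.
   Context: Query algorithms are represented as binary decision trees. An $n$-variable randomized decision tree is a binary tree with two types of internal nodes: decision nodes, which branch on the value of one of the boolean variables $x_1,\dots,x_n$, and stochastic nodes, which branch on the outcome of an independent $\mathrm{Bernoulli}(\frac12)$ random bit. Leaves are labelled by values in $[0,1]$. Its query complexity is the maximum number of decision nodes on any root-to-leaf path, and its randomness complexity is the maximum number $m$ of stochastic nodes on any root-to-leaf path. $R(x,r)$ is the label of the leaf reached on input $x$ when the stochastic nodes encountered branch according to the bits of $r\in\{0,1\}^m$. A randomized $q$-query algorithm is such a tree of query complexity at most $q$; here $n,q\ge1$. -}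

module Defs where

open import Algebra.Bundles using (CommutativeRing)
open import Algebra.Core using (Op₁; Op₂)
open import Algebra.Structures using (IsCommutativeRing)
import Algebra.Construct.NaturalChoice.Max as NaturalMax
import Algebra.Definitions.RawMonoid as RawMonoidDefs
import Algebra.Properties.Ring as RingProperties
import Relation.Binary.Reasoning.Setoid as SetoidReasoning
open import Data.Bool.Base using (Bool; true; false; not; if_then_else_)
open import Data.Fin.Base using (Fin)
open import Data.Nat.Base as ℕ using (ℕ; zero; suc; NonZero; s≤s⁻¹)
open import Data.Nat.Properties as ℕ using (m^n≢0; m⊔n≤o⇒m≤o; m⊔n≤o⇒n≤o)
open import Data.Product.Base using (∃; proj₁)
open import Data.Sum.Base using (inj₁; inj₂)
open import Data.Vec.Base using (Vec; []; _∷_; lookup; _[_]%=_)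
open import Level using (Level; _⊔_) renaming (suc to lsuc)
open import Relation.Binary.Bundles using (TotalOrder)
open import Relation.Binary.Core using (Rel)
open import Relation.Binary.Structures using (IsTotalOrder)
open import Relation.Nullary.Negation using (¬_)

-- Totally ordered fields.  Classically ℝ is one, and the rationals are another.
-- Everything below uses only the ordered-field structure of the real numbers,
-- so the codomain [0,1] is taken inside an arbitrary such field.
record OrderedField (c ℓ₁ ℓ₂ : Level) : Set (lsuc (c ⊔ ℓ₁ ⊔ ℓ₂)) where
  infix  8 -_
  infixl 7 _*_
  infixl 6 _+_
  infix  4 _≈_ _≤_
  field
    Carrier           : Set c
    _≈_               : Rel Carrier ℓ₁
    _≤_               : Rel Carrier ℓ₂
    _+_ _*_           : Op₂ Carrier
    -_                : Op₁ Carrier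
    0# 1#             : Carrier
    isCommutativeRing : IsCommutativeRing _≈_ _+_ _*_ -_ 0# 1#
    isTotalOrder      : IsTotalOrder _≈_ _≤_
    1≉0               : ¬ (1# ≈ 0#)
    inverse           : ∀ x → ¬ (x ≈ 0#) → ∃ λ y → x * y ≈ 1#
    +-monoʳ-≤         : ∀ z {x y} → x ≤ y → z + x ≤ z + y
    *-nonNeg          : ∀ {x y} → 0# ≤ x → 0# ≤ y → 0# ≤ x * y

  commutativeRing : CommutativeRing c ℓ₁
  commutativeRing = record { isCommutativeRing = isCommutativeRing }

  totalOrder : TotalOrder c ℓ₁ ℓ₂
  totalOrder = record { isTotalOrder = isTotalOrder }

module OrderedFieldOps {c ℓ₁ ℓ₂} (F : OrderedField c ℓ₁ ℓ₂) where
  open OrderedField F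
  open CommutativeRing commutativeRing
    using (ring; setoid; sym; +-rawMonoid; _-_; -‿cong;
           +-identityʳ; -‿inverseˡ; *-identityʳ)
  open TotalOrder totalOrder
    using (total; antisym; ≤-respˡ-≈; ≤-respʳ-≈)
    renaming (refl to ≤-refl; trans to ≤-trans)
  open RingProperties ring using (-‿distribʳ-*; -‿involutive)
  open NaturalMax totalOrder using () renaming (_⊔_ to max)
  open RawMonoidDefs +-rawMonoid using (_×_)

  0≤1 : 0# ≤ 1#
  0≤1 with total 0# 1#
  ... | inj₁ 0≤1′ = 0≤1′
  ... | inj₂ 1≤0  = ≤-respʳ-≈ [-1]²≈1 (*-nonNeg 0≤-1 0≤-1)
    where
    open SetoidReasoning setoid

    0≤-1 : 0# ≤ - 1#
    0≤-1 = ≤-respˡ-≈ (-‿inverseˡ 1#) (≤-respʳ-≈ (+-identityʳ (- 1#)) (+-monoʳ-≤ (- 1#) 1≤0))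

    [-1]²≈1 : (- 1#) * (- 1#) ≈ 1#
    [-1]²≈1 = begin
      (- 1#) * (- 1#)  ≈⟨ sym (-‿distribʳ-* (- 1#) 1#) ⟩
      - ((- 1#) * 1#)  ≈⟨ -‿cong (*-identityʳ (- 1#)) ⟩
      - (- 1#)         ≈⟨ -‿involutive 1# ⟩
      1#               ∎

  1≤1+k : ∀ k → 1# ≤ suc k × 1#
  0≤k   : ∀ k → 0# ≤ k × 1#
  1≤1+k k = ≤-respˡ-≈ (+-identityʳ 1#) (+-monoʳ-≤ 1# (0≤k k))
  0≤k zero    = ≤-refl
  0≤k (suc k) = ≤-trans 0≤1 (1≤1+k k)

  1+k≉0 : ∀ k → ¬ (suc k × 1# ≈ 0#)
  1+k≉0 k 1+k≈0 = 1≉0 (antisym (≤-respʳ-≈ 1+k≈0 (1≤1+k k)) 0≤1)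

  infixl 7 _/_
  _/_ : Carrier → (k : ℕ) .{{_ : NonZero k}} → Carrier
  x / suc k = x * proj₁ (inverse (suc k × 1#) (1+k≉0 k))

  ∣_∣ : Carrier → Carrier
  ∣ x ∣ = max x (- x)

  ∑ : ∀ {k} → (Vec Bool k → Carrier) → Carrier
  ∑ {zero}  f = f []
  ∑ {suc k} f = ∑ (λ v → f (false ∷ v)) + ∑ (λ v → f (true ∷ v))

  𝔼 : ∀ {k} → (Vec Bool k → Carrier) → Carrier
  𝔼 {k} f = _/_ (∑ f) (2 ℕ.^ k) {{m^n≢0 2 k}}

  Var : ∀ {n} → (Vec Bool n → Carrier) → Carrier
  Var f = 𝔼 λ x → (f x - 𝔼 f) * (f x - 𝔼 f)

  infixl 6 _^⊕_
  _^⊕_ : ∀ {n} → Vec Bool n → Fin n → Vec Bool n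
  x ^⊕ i = x [ i ]%= not

  Inf : ∀ {n} → Fin n → (Vec Bool n → Carrier) → Carrier
  Inf i f = 𝔼 λ x → ∣ f x - f (x ^⊕ i) ∣

module DecisionTrees {c ℓ₁ ℓ₂} (F : OrderedField c ℓ₁ ℓ₂) where
  open OrderedField F public
  open OrderedFieldOps F public

  -- At both kinds of internal node the first subtree is taken on false and the
  -- second on true.
  data Tree (n : ℕ) : Set (c ⊔ ℓ₂) where
    leaf       : (a : Carrier) → 0# ≤ a → a ≤ 1# → Tree n
    decision   : Fin n → Tree n → Tree n → Tree n
    stochastic : Tree n → Tree n → Tree n

  queryComplexity : ∀ {n} → Tree n → ℕ
  queryComplexity (leaf _ _ _)     = 0
  queryComplexity (decision _ s t) = suc (queryComplexity s ℕ.⊔ queryComplexity t)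
  queryComplexity (stochastic s t) = queryComplexity s ℕ.⊔ queryComplexity t

  randomnessComplexity : ∀ {n} → Tree n → ℕ
  randomnessComplexity (leaf _ _ _)     = 0
  randomnessComplexity (decision _ s t) = randomnessComplexity s ℕ.⊔ randomnessComplexity t
  randomnessComplexity (stochastic s t) = suc (randomnessComplexity s ℕ.⊔ randomnessComplexity t)

  -- The j-th stochastic node met on the path consumes the j-th bit of r; bits
  -- left over when a leaf is reached are ignored.
  evalWith : ∀ {n m} (t : Tree n) → .(randomnessComplexity t ℕ.≤ m) →
             Vec Bool n → Vec Bool m → Carrier
  evalWith (leaf a _ _)     _ x r = a
  evalWith (decision i s t) p x r =
    if lookup x i
      then evalWith t (m⊔n≤o⇒n≤o (randomnessComplexity s) _ p) x r
      else evalWith s (m⊔n≤o⇒m≤o _ (randomnessComplexity t) p) x r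
  evalWith (stochastic s t) () x []
  evalWith (stochastic s t) p x (b ∷ r) =
    if b
      then evalWith t (m⊔n≤o⇒n≤o (randomnessComplexity s) _ (s≤s⁻¹ p)) x r
      else evalWith s (m⊔n≤o⇒m≤o _ (randomnessComplexity t) (s≤s⁻¹ p)) x r

  eval : ∀ {n} (R : Tree n) → Vec Bool n → Vec Bool (randomnessComplexity R) → Carrier
  eval R = evalWith R ℕ.≤-refl

  mean : ∀ {n} → Tree n → Vec Bool n → Carrier
  mean R x = 𝔼 λ r → eval R x r

{-# OPTIONS --safe #-}
module Submission where

-- Let μ be the mean of R.  Since μ is itself computed by the tree R, it is
-- enough to show that a tree making at most k queries correlates only weakly
-- with any function f whose coordinates all have influence at most M:
--
--     E[f · value t]  ≤  E[f] · E[value t] + k · M          (correlation-bound)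
--
-- where value t x is the expected output of t on the input x.  Taking f = μ,
-- t = R and M the largest influence of μ gives Var(μ) ≤ q · M.  Allowing f to
-- differ from value t is essential, because the induction changes f and the
-- tree separately.
--
-- The bound is proved one query at a time.  At a leaf value t is constant, so
-- the correlation is zero.  A stochastic node averages the values of its two
-- subtrees, and both sides of the bound are affine in value t.  At a decision
-- node querying i, first replace f by its average f̄ over the i-th coordinate.
-- Outputs lie in [0,1], so this changes E[f · value t] by at most Inf_i(f) ≤ M
-- (*≤avg*+∣-∣).  Now f̄ ignores the i-th coordinate, so only the average of
-- value t over that coordinate matters, and that average is the value of
-- the tree which tosses a coin instead of querying x_i (𝔼-decision).  The new
-- tree has query complexity at most k - 1, and f̄ has the same mean as f and no
-- larger influences (Inf-symmetrise), so induction applies.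
--
-- This is a tree form of the hybrid argument for the inequality of O'Donnell,
-- Saks, Schramm and Servedio: queried coordinates are rerandomised one by one
-- until the function no longer depends on what the tree has seen.

open import Defs
open import Data.Nat.Base as ℕ using (ℕ; zero; suc; NonZero; z≤n; s≤s; s≤s⁻¹)
open import Data.Fin.Base using (Fin; zero; suc)
open import Data.Product.Base using (Σ-syntax; _,_; proj₁; proj₂)

open import Algebra.Bundles using (CommutativeRing)
import Algebra.Construct.NaturalChoice.Max as NaturalMax
import Algebra.Properties.Ring as RingProperties
import Algebra.Properties.Semiring.Mult as SemiringMult
import Algebra.Solver.Ring.NaturalCoefficients.Default as NaturalSolver
open import Data.Bool.Base using (Bool; true; false; not; if_then_else_)
open import Data.Fin.Properties using (_≟_)
import Data.List.Extrema as Extrema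
open import Data.List.Base using (allFin)
open import Data.List.Membership.Propositional.Properties using (∈-allFin)
import Data.List.Relation.Unary.All as All
import Data.Nat.Properties as ℕₚ
open import Data.Sum.Base using (inj₁; inj₂)
open import Data.Vec.Base using (Vec; []; _∷_; lookup; _[_]≔_)
open import Data.Vec.Properties
  using (lookup∘update; lookup∘update′; []≔-lookup; updateAt-cong-local; updateAt-commutes)
open import Relation.Binary.Bundles using (TotalOrder)
import Relation.Binary.Reasoning.PartialOrder as PosetReasoning
open import Relation.Binary.PropositionalEquality.Core as ≡ using (_≡_)
open import Relation.Nullary.Decidable.Core using (yes; no)
open import Relation.Nullary.Negation using (contradiction)

module _ {c ℓ₁ ℓ₂} (F : OrderedField c ℓ₁ ℓ₂) where
  open DecisionTrees F
  open CommutativeRing commutativeRing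
    using (ring; semiring; commutativeSemiring; _-_; sym; trans; refl; reflexive;
           -‿cong; +-cong; +-congˡ; +-congʳ; +-comm; +-assoc; +-identityˡ; +-identityʳ;
           -‿inverseˡ; -‿inverseʳ; *-cong; *-congˡ; *-congʳ; *-comm; *-assoc;
           *-identityˡ; *-identityʳ; distribˡ; distribʳ; zeroˡ; zeroʳ)
  open TotalOrder totalOrder
    using (total; antisym; poset; ≤-respˡ-≈; ≤-respʳ-≈)
    renaming (trans to ≤-trans; reflexive to ≤-reflexive)
  open RingProperties ring using (-‿distribʳ-*; -‿+-comm; xyx⁻¹≈y)
  open SemiringMult semiring using (_×_; ×1-homo-*)
  open NaturalMax totalOrder using (x≤x⊔y; x≤y⊔x; ⊔-lub)
  open NaturalSolver commutativeSemiring using (solve; _:=_; _:+_; _:*_)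
  open PosetReasoning poset

  -- Order and absolute value in an ordered field

  +-monoˡ-≤ : ∀ z {x y} → x ≤ y → x + z ≤ y + z
  +-monoˡ-≤ z {x} {y} x≤y = begin
    x + z  ≈⟨ +-comm x z ⟩
    z + x  ≤⟨ +-monoʳ-≤ z x≤y ⟩
    z + y  ≈⟨ +-comm z y ⟩
    y + z  ∎

  +-mono-≤ : ∀ {x y u v} → x ≤ y → u ≤ v → x + u ≤ y + v
  +-mono-≤ {y = y} {u} x≤y u≤v = ≤-trans (+-monoˡ-≤ u x≤y) (+-monoʳ-≤ y u≤v)

  x≤x+y : ∀ {x y} → 0# ≤ y → x ≤ x + y
  x≤x+y {x} 0≤y = ≤-respˡ-≈ (+-identityʳ x) (+-monoʳ-≤ x 0≤y)

  *-monoˡ-≤ : ∀ {z} → 0# ≤ z → ∀ {x y} → x ≤ y → z * x ≤ z * y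
  *-monoˡ-≤ {z} 0≤z {x} {y} x≤y = begin
    z * x                  ≤⟨ x≤x+y (*-nonNeg 0≤z 0≤-x+y) ⟩
    z * x + z * (- x + y)  ≈⟨ distribˡ z x (- x + y) ⟨
    z * (x + (- x + y))    ≈⟨ *-congˡ (+-assoc x (- x) y) ⟨
    z * (x - x + y)        ≈⟨ *-congˡ (+-congʳ (-‿inverseʳ x)) ⟩
    z * (0# + y)           ≈⟨ *-congˡ (+-identityˡ y) ⟩
    z * y                  ∎
    where
    0≤-x+y : 0# ≤ - x + y
    0≤-x+y = ≤-respˡ-≈ (-‿inverseˡ x) (+-monoʳ-≤ (- x) x≤y)

  *-monoʳ-≤ : ∀ {z} → 0# ≤ z → ∀ {x y} → x ≤ y → x * z ≤ y * z
  *-monoʳ-≤ {z} 0≤z {x} {y} x≤y = begin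
    x * z  ≈⟨ *-comm x z ⟩
    z * x  ≤⟨ *-monoˡ-≤ 0≤z x≤y ⟩
    z * y  ≈⟨ *-comm z y ⟩
    y * z  ∎

  ∣x∣≤y : ∀ {x y} → x ≤ y → - x ≤ y → ∣ x ∣ ≤ y
  ∣x∣≤y = ⊔-lub

  x≤∣x∣ : ∀ x → x ≤ ∣ x ∣
  x≤∣x∣ x = x≤x⊔y x (- x)

  -x≤∣x∣ : ∀ x → - x ≤ ∣ x ∣
  -x≤∣x∣ x = x≤y⊔x x (- x)

  0≤∣x∣ : ∀ x → 0# ≤ ∣ x ∣
  0≤∣x∣ x with total 0# x
  ... | inj₁ 0≤x = ≤-trans 0≤x (x≤∣x∣ x)
  ... | inj₂ x≤0 = ≤-trans 0≤-x (-x≤∣x∣ x)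
    where
    0≤-x : 0# ≤ - x
    0≤-x = ≤-respˡ-≈ (-‿inverseˡ x) (≤-respʳ-≈ (+-identityʳ (- x)) (+-monoʳ-≤ (- x) x≤0))

  -- Division by positive integers

  *-/ : ∀ x k .{{_ : NonZero k}} → (k × 1#) * (x / k) ≈ x
  *-/ x (suc k) = begin-equality
    K * (x * K⁻¹)  ≈⟨ solve 3 (λ k x l → k :* (x :* l) := x :* (k :* l)) refl K x K⁻¹ ⟩
    x * (K * K⁻¹)  ≈⟨ *-congˡ (proj₂ (inverse K (1+k≉0 k))) ⟩
    x * 1#         ≈⟨ *-identityʳ x ⟩
    x              ∎
    where
    K K⁻¹ : Carrier
    K   = suc k × 1#
    K⁻¹ = proj₁ (inverse K (1+k≉0 k))

  *-cancelˡ : ∀ k .{{_ : NonZero k}} {x y} → (k × 1#) * x ≈ (k × 1#) * y → x ≈ y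
  *-cancelˡ k {x} {y} kx≈ky = begin-equality
    x                           ≈⟨ cancelled x ⟨
    (1# / k) * ((k × 1#) * x)   ≈⟨ *-congˡ kx≈ky ⟩
    (1# / k) * ((k × 1#) * y)   ≈⟨ cancelled y ⟩
    y                           ∎
    where
    cancelled : ∀ z → (1# / k) * ((k × 1#) * z) ≈ z
    cancelled z = begin-equality
      (1# / k) * ((k × 1#) * z)  ≈⟨ solve 3 (λ l k z → l :* (k :* z) := (k :* l) :* z) refl (1# / k) (k × 1#) z ⟩
      ((k × 1#) * (1# / k)) * z  ≈⟨ *-congʳ (*-/ 1# k) ⟩
      1# * z                     ≈⟨ *-identityˡ z ⟩
      z                          ∎

  0≤1/ : ∀ k .{{_ : NonZero k}} → 0# ≤ 1# / k
  0≤1/ k with total 0# (1# / k)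
  ... | inj₁ 0≤1/k = 0≤1/k
  ... | inj₂ 1/k≤0 = contradiction (antisym 1≤0 0≤1) 1≉0
    where
    1≤0 : 1# ≤ 0#
    1≤0 = begin
      1#                   ≈⟨ *-/ 1# k ⟨
      (k × 1#) * (1# / k)  ≤⟨ *-monoˡ-≤ (0≤k k) 1/k≤0 ⟩
      (k × 1#) * 0#        ≈⟨ zeroʳ (k × 1#) ⟩
      0#                   ∎

  x/k≈1/k*x : ∀ x k .{{_ : NonZero k}} → x / k ≈ (1# / k) * x
  x/k≈1/k*x x k = *-cancelˡ k (begin-equality
    (k × 1#) * (x / k)         ≈⟨ *-/ x k ⟩
    x                          ≈⟨ *-identityˡ x ⟨
    1# * x                     ≈⟨ *-congʳ (*-/ 1# k) ⟨
    (k × 1#) * (1# / k) * x    ≈⟨ *-assoc (k × 1#) (1# / k) x ⟩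
    (k × 1#) * ((1# / k) * x)  ∎)

  x≤ky⇒x/k≤y : ∀ k .{{_ : NonZero k}} {x y} → x ≤ (k × 1#) * y → x / k ≤ y
  x≤ky⇒x/k≤y k {x} {y} x≤ky = begin
    x / k                      ≈⟨ x/k≈1/k*x x k ⟩
    (1# / k) * x               ≤⟨ *-monoˡ-≤ (0≤1/ k) x≤ky ⟩
    (1# / k) * ((k × 1#) * y)  ≈⟨ x/k≈1/k*x ((k × 1#) * y) k ⟨
    ((k × 1#) * y) / k         ≈⟨ *-cancelˡ k (*-/ ((k × 1#) * y) k) ⟩
    y                          ∎

  -- Averages of two elements

  ½ : Carrier
  ½ = 1# / 2

  avg : Carrier → Carrier → Carrier
  avg x y = ½ * (x + y)

  ½+½≈1 : ½ + ½ ≈ 1#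
  ½+½≈1 = begin-equality
    ½ + ½            ≈⟨ +-cong (*-identityˡ ½) (*-identityˡ ½) ⟨
    1# * ½ + 1# * ½  ≈⟨ distribʳ ½ 1# 1# ⟨
    (1# + 1#) * ½    ≈⟨ *-congʳ (+-congˡ (+-identityʳ 1#)) ⟨
    (2 × 1#) * ½     ≈⟨ *-/ 1# 2 ⟩
    1#               ∎

  avg-idem : ∀ x → avg x x ≈ x
  avg-idem x = begin-equality
    ½ * (x + x)  ≈⟨ solve 2 (λ h x → h :* (x :+ x) := (h :+ h) :* x) refl ½ x ⟩
    (½ + ½) * x  ≈⟨ *-congʳ ½+½≈1 ⟩
    1# * x       ≈⟨ *-identityˡ x ⟩
    x            ∎

  avg-cong : ∀ {x y u v} → x ≈ y → u ≈ v → avg x u ≈ avg y v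
  avg-cong x≈y u≈v = *-congˡ (+-cong x≈y u≈v)

  avg-comm : ∀ x y → avg x y ≈ avg y x
  avg-comm x y = *-congˡ (+-comm x y)

  avg-mono : ∀ {x y u v} → x ≤ y → u ≤ v → avg x u ≤ avg y v
  avg-mono x≤y u≤v = *-monoˡ-≤ (0≤1/ 2) (+-mono-≤ x≤y u≤v)

  avg-+ : ∀ w x y z → avg (w + x) (y + z) ≈ avg w y + avg x z
  avg-+ w x y z = solve 5 (λ h w x y z →
    h :* ((w :+ x) :+ (y :+ z)) := h :* (w :+ y) :+ h :* (x :+ z)) refl ½ w x y z

  avg-*ʳ : ∀ z x y → avg (x * z) (y * z) ≈ avg x y * z
  avg-*ʳ z x y = solve 4 (λ h z x y →
    h :* (x :* z :+ y :* z) := h :* (x :+ y) :* z) refl ½ z x y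

  avg-*ˡ : ∀ z x y → avg (z * x) (z * y) ≈ z * avg x y
  avg-*ˡ z x y = solve 4 (λ h z x y →
    h :* (z :* x :+ z :* y) := z :* (h :* (x :+ y))) refl ½ z x y

  ∣avg-avg∣≤ : ∀ w x y z → ∣ avg w x - avg y z ∣ ≤ avg ∣ w - y ∣ ∣ x - z ∣
  ∣avg-avg∣≤ w x y z = ∣x∣≤y
    (begin
      avg w x - avg y z              ≈⟨ difference ⟩
      avg (w - y) (x - z)            ≤⟨ avg-mono (x≤∣x∣ (w - y)) (x≤∣x∣ (x - z)) ⟩
      avg ∣ w - y ∣ ∣ x - z ∣        ∎)
    (begin
      - (avg w x - avg y z)          ≈⟨ -‿cong difference ⟩
      - avg (w - y) (x - z)          ≈⟨ neg (w - y) (x - z) ⟩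
      avg (- (w - y)) (- (x - z))    ≤⟨ avg-mono (-x≤∣x∣ (w - y)) (-x≤∣x∣ (x - z)) ⟩
      avg ∣ w - y ∣ ∣ x - z ∣        ∎)
    where
    neg : ∀ a b → - avg a b ≈ avg (- a) (- b)
    neg a b = trans (-‿distribʳ-* ½ (a + b)) (*-congˡ (sym (-‿+-comm a b)))

    difference : avg w x - avg y z ≈ avg (w - y) (x - z)
    difference = trans (+-congˡ (neg y z)) (sym (avg-+ w (- y) x (- z)))

  -- The cost of replacing x by its average with y under a weight v in [0,1]:
  -- x exceeds the average by half of x - y, and weighting by v keeps the excess
  -- below ∣ x - y ∣.
  *≤avg*+∣-∣ : ∀ x y {v} → 0# ≤ v → v ≤ 1# → x * v ≤ avg x y * v + ∣ x - y ∣
  *≤avg*+∣-∣ x y {v} 0≤v v≤1 = begin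
    x * v                                ≈⟨ *-congʳ (sym x≈) ⟩
    (avg x y + ½ * (x - y)) * v          ≈⟨ solve 4 (λ m h d v → (m :+ h :* d) :* v := m :* v :+ (h :* v) :* d) refl (avg x y) ½ (x - y) v ⟩
    avg x y * v + (½ * v) * (x - y)      ≤⟨ +-monoʳ-≤ _ (*-monoˡ-≤ (*-nonNeg (0≤1/ 2) 0≤v) (x≤∣x∣ (x - y))) ⟩
    avg x y * v + (½ * v) * ∣ x - y ∣    ≤⟨ +-monoʳ-≤ _ (*-monoʳ-≤ (0≤∣x∣ (x - y)) ½v≤1) ⟩
    avg x y * v + 1# * ∣ x - y ∣         ≈⟨ +-congˡ (*-identityˡ _) ⟩
    avg x y * v + ∣ x - y ∣              ∎
    where
    x≈ : avg x y + ½ * (x - y) ≈ x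
    x≈ = begin-equality
      avg x y + ½ * (x - y)      ≈⟨ solve 4 (λ h x y z → h :* (x :+ y) :+ h :* (x :+ z) := h :* (x :+ x) :+ h :* (y :+ z)) refl ½ x y (- y) ⟩
      avg x x + ½ * (y - y)      ≈⟨ +-cong (avg-idem x) (trans (*-congˡ (-‿inverseʳ y)) (zeroʳ ½)) ⟩
      x + 0#                     ≈⟨ +-identityʳ x ⟩
      x                          ∎

    ½v≤1 : ½ * v ≤ 1#
    ½v≤1 = begin
      ½ * v      ≤⟨ *-monoˡ-≤ (0≤1/ 2) (≤-trans v≤1 (x≤x+y 0≤1)) ⟩
      avg 1# 1#  ≈⟨ avg-idem 1# ⟩
      1#         ∎

  -- Expectations over the cube

  𝔼-[] : (f : Vec Bool 0 → Carrier) → 𝔼 f ≈ f []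
  𝔼-[] f = begin-equality
    f [] / 1            ≈⟨ *-identityˡ _ ⟨
    1# * (f [] / 1)     ≈⟨ *-congʳ (+-identityʳ 1#) ⟨
    (1 × 1#) * (f [] / 1) ≈⟨ *-/ (f []) 1 ⟩
    f []                ∎

  -- Conditioning on the first bit presents 𝔼 as an iterated average, so that
  -- the properties of 𝔼 follow by induction from those of avg.
  𝔼-∷ : ∀ {k} (f : Vec Bool (suc k) → Carrier) →
        𝔼 f ≈ avg (𝔼 λ v → f (false ∷ v)) (𝔼 λ v → f (true ∷ v))
  𝔼-∷ {k} f = *-cancelˡ (2 ℕ.^ suc k) {{ℕₚ.m^n≢0 2 (suc k)}} (begin-equality
    ((2 ℕ.^ suc k) × 1#) * 𝔼 f             ≈⟨ *-/ (∑ f) (2 ℕ.^ suc k) {{ℕₚ.m^n≢0 2 (suc k)}} ⟩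
    ∑ f₀ + ∑ f₁                          ≈⟨ +-cong (*-/ (∑ f₀) (2 ℕ.^ k) {{ℕₚ.m^n≢0 2 k}}) (*-/ (∑ f₁) (2 ℕ.^ k) {{ℕₚ.m^n≢0 2 k}}) ⟨
    N * 𝔼 f₀ + N * 𝔼 f₁                  ≈⟨ distribˡ N (𝔼 f₀) (𝔼 f₁) ⟨
    N * (𝔼 f₀ + 𝔼 f₁)                    ≈⟨ *-identityˡ _ ⟨
    1# * (N * (𝔼 f₀ + 𝔼 f₁))             ≈⟨ *-congʳ (*-/ 1# 2) ⟨
    (2 × 1#) * ½ * (N * (𝔼 f₀ + 𝔼 f₁))   ≈⟨ solve 4 (λ t h n s → (t :* h) :* (n :* s) := (t :* n) :* (h :* s)) refl (2 × 1#) ½ N (𝔼 f₀ + 𝔼 f₁) ⟩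
    (2 × 1#) * N * avg (𝔼 f₀) (𝔼 f₁)     ≈⟨ *-congʳ (×1-homo-* 2 (2 ℕ.^ k)) ⟨
    ((2 ℕ.^ suc k) × 1#) * avg (𝔼 f₀) (𝔼 f₁)  ∎)
    where
    f₀ f₁ : Vec Bool k → Carrier
    f₀ v = f (false ∷ v)
    f₁ v = f (true ∷ v)

    N : Carrier
    N = (2 ℕ.^ k) × 1#

  𝔼-mono : ∀ {k} {f g : Vec Bool k → Carrier} → (∀ x → f x ≤ g x) → 𝔼 f ≤ 𝔼 g
  𝔼-mono {zero}  {f} {g} f≤g = begin
    𝔼 f   ≈⟨ 𝔼-[] f ⟩
    f []  ≤⟨ f≤g [] ⟩
    g []  ≈⟨ 𝔼-[] g ⟨
    𝔼 g   ∎
  𝔼-mono {suc k} {f} {g} f≤g = begin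
    𝔼 f                                                  ≈⟨ 𝔼-∷ f ⟩
    avg (𝔼 λ v → f (false ∷ v)) (𝔼 λ v → f (true ∷ v))   ≤⟨ avg-mono (𝔼-mono λ v → f≤g (false ∷ v)) (𝔼-mono λ v → f≤g (true ∷ v)) ⟩
    avg (𝔼 λ v → g (false ∷ v)) (𝔼 λ v → g (true ∷ v))   ≈⟨ 𝔼-∷ g ⟨
    𝔼 g                                                  ∎

  𝔼-cong : ∀ {k} {f g : Vec Bool k → Carrier} → (∀ x → f x ≈ g x) → 𝔼 f ≈ 𝔼 g
  𝔼-cong f≈g = antisym (𝔼-mono λ x → ≤-reflexive (f≈g x))
                       (𝔼-mono λ x → ≤-reflexive (sym (f≈g x)))

  𝔼-const : ∀ {k} a → 𝔼 {k} (λ _ → a) ≈ a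
  𝔼-const {zero}  a = 𝔼-[] (λ _ → a)
  𝔼-const {suc k} a =
    trans (𝔼-∷ {k} (λ _ → a)) (trans (avg-cong (𝔼-const {k} a) (𝔼-const {k} a)) (avg-idem a))

  𝔼-+ : ∀ {k} (f g : Vec Bool k → Carrier) → 𝔼 (λ x → f x + g x) ≈ 𝔼 f + 𝔼 g
  𝔼-+ {zero}  f g = trans (𝔼-[] (λ x → f x + g x)) (sym (+-cong (𝔼-[] f) (𝔼-[] g)))
  𝔼-+ {suc k} f g = begin-equality
    𝔼 (λ x → f x + g x)                    ≈⟨ 𝔼-∷ (λ x → f x + g x) ⟩
    avg (𝔼 λ v → f (false ∷ v) + g (false ∷ v)) (𝔼 λ v → f (true ∷ v) + g (true ∷ v))
      ≈⟨ avg-cong (𝔼-+ {k} _ _) (𝔼-+ {k} _ _) ⟩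
    avg (𝔼 (λ v → f (false ∷ v)) + 𝔼 (λ v → g (false ∷ v))) (𝔼 (λ v → f (true ∷ v)) + 𝔼 (λ v → g (true ∷ v)))
      ≈⟨ avg-+ _ _ _ _ ⟩
    avg (𝔼 λ v → f (false ∷ v)) (𝔼 λ v → f (true ∷ v)) + avg (𝔼 λ v → g (false ∷ v)) (𝔼 λ v → g (true ∷ v))
      ≈⟨ +-cong (𝔼-∷ f) (𝔼-∷ g) ⟨
    𝔼 f + 𝔼 g                              ∎

  𝔼-*ʳ : ∀ {k} (f : Vec Bool k → Carrier) a → 𝔼 (λ x → f x * a) ≈ 𝔼 f * a
  𝔼-*ʳ {zero}  f a = trans (𝔼-[] (λ x → f x * a)) (*-congʳ (sym (𝔼-[] f)))
  𝔼-*ʳ {suc k} f a = begin-equality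
    𝔼 (λ x → f x * a)                                                ≈⟨ 𝔼-∷ (λ x → f x * a) ⟩
    avg (𝔼 λ v → f (false ∷ v) * a) (𝔼 λ v → f (true ∷ v) * a)       ≈⟨ avg-cong (𝔼-*ʳ {k} _ a) (𝔼-*ʳ {k} _ a) ⟩
    avg ((𝔼 λ v → f (false ∷ v)) * a) ((𝔼 λ v → f (true ∷ v)) * a)   ≈⟨ avg-*ʳ a _ _ ⟩
    avg (𝔼 λ v → f (false ∷ v)) (𝔼 λ v → f (true ∷ v)) * a           ≈⟨ *-congʳ (𝔼-∷ f) ⟨
    𝔼 f * a                                                          ∎

  𝔼-avg : ∀ {k} (f g : Vec Bool k → Carrier) → 𝔼 (λ x → avg (f x) (g x)) ≈ avg (𝔼 f) (𝔼 g)
  𝔼-avg f g = begin-equality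
    𝔼 (λ x → ½ * (f x + g x))  ≈⟨ 𝔼-cong (λ x → *-comm ½ (f x + g x)) ⟩
    𝔼 (λ x → (f x + g x) * ½)  ≈⟨ 𝔼-*ʳ (λ x → f x + g x) ½ ⟩
    𝔼 (λ x → f x + g x) * ½    ≈⟨ *-comm _ ½ ⟩
    ½ * 𝔼 (λ x → f x + g x)    ≈⟨ *-congˡ (𝔼-+ f g) ⟩
    avg (𝔼 f) (𝔼 g)            ∎

  𝔼-^⊕ : ∀ {n} (i : Fin n) (f : Vec Bool n → Carrier) → 𝔼 (λ x → f (x ^⊕ i)) ≈ 𝔼 f
  𝔼-^⊕ zero f = begin-equality
    𝔼 (λ x → f (x ^⊕ zero))                             ≈⟨ 𝔼-∷ (λ x → f (x ^⊕ zero)) ⟩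
    avg (𝔼 λ v → f (true ∷ v)) (𝔼 λ v → f (false ∷ v))  ≈⟨ avg-comm _ _ ⟩
    avg (𝔼 λ v → f (false ∷ v)) (𝔼 λ v → f (true ∷ v))  ≈⟨ 𝔼-∷ f ⟨
    𝔼 f                                                 ∎
  𝔼-^⊕ (suc i) f = begin-equality
    𝔼 (λ x → f (x ^⊕ suc i))                            ≈⟨ 𝔼-∷ (λ x → f (x ^⊕ suc i)) ⟩
    avg (𝔼 λ v → f (false ∷ v ^⊕ i)) (𝔼 λ v → f (true ∷ v ^⊕ i))
      ≈⟨ avg-cong (𝔼-^⊕ i (λ v → f (false ∷ v))) (𝔼-^⊕ i (λ v → f (true ∷ v))) ⟩
    avg (𝔼 λ v → f (false ∷ v)) (𝔼 λ v → f (true ∷ v))  ≈⟨ 𝔼-∷ f ⟨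
    𝔼 f                                                 ∎

  symmetrise : ∀ {n} → Fin n → (Vec Bool n → Carrier) → Vec Bool n → Carrier
  symmetrise i f x = avg (f x) (f (x ^⊕ i))

  𝔼-symmetrise : ∀ {n} (i : Fin n) (f : Vec Bool n → Carrier) →
                 𝔼 (symmetrise i f) ≈ 𝔼 f
  𝔼-symmetrise i f = begin-equality
    𝔼 (symmetrise i f)                   ≈⟨ 𝔼-avg f (λ x → f (x ^⊕ i)) ⟩
    avg (𝔼 f) (𝔼 λ x → f (x ^⊕ i))       ≈⟨ avg-cong refl (𝔼-^⊕ i f) ⟩
    avg (𝔼 f) (𝔼 f)                      ≈⟨ avg-idem (𝔼 f) ⟩
    𝔼 f                                  ∎

  Var-≈ : ∀ {n} (f : Vec Bool n → Carrier) →
          Var f ≈ 𝔼 (λ x → f x * f x) - 𝔼 f * 𝔼 f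
  Var-≈ {n} f = begin-equality
    𝔼 (λ x → (f x + m) * (f x + m))
      ≈⟨ 𝔼-cong (λ x → solve 2 (λ a m → (a :+ m) :* (a :+ m) := a :* a :+ (a :* (m :+ m) :+ m :* m)) refl (f x) m) ⟩
    𝔼 (λ x → f x * f x + (f x * (m + m) + m * m))
      ≈⟨ 𝔼-+ (λ x → f x * f x) (λ x → f x * (m + m) + m * m) ⟩
    s + 𝔼 (λ x → f x * (m + m) + m * m)
      ≈⟨ +-congˡ (𝔼-+ (λ x → f x * (m + m)) (λ _ → m * m)) ⟩
    s + (𝔼 (λ x → f x * (m + m)) + 𝔼 {n} (λ _ → m * m))
      ≈⟨ +-congˡ (+-cong (𝔼-*ʳ f (m + m)) (𝔼-const {n} (m * m))) ⟩
    s + (e * (m + m) + m * m)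
      ≈⟨ solve 3 (λ s e m → s :+ (e :* (m :+ m) :+ m :* m) := (s :+ e :* m) :+ (e :+ m) :* m) refl s e m ⟩
    s + e * m + (e + m) * m
      ≈⟨ +-congˡ (trans (*-congʳ (-‿inverseʳ e)) (zeroˡ m)) ⟩
    s + e * m + 0#
      ≈⟨ +-identityʳ _ ⟩
    s + e * m
      ≈⟨ +-congˡ (-‿distribʳ-* e e) ⟨
    s - e * e  ∎
    where
    e m s : Carrier
    e = 𝔼 f
    m = - e
    s = 𝔼 (λ x → f x * f x)

  -- Influences and averaging over a coordinate

  Inf-nonNeg : ∀ {n} (i : Fin n) (f : Vec Bool n → Carrier) → 0# ≤ Inf i f
  Inf-nonNeg {n} i f = ≤-respˡ-≈ (𝔼-const {n} 0#) (𝔼-mono λ x → 0≤∣x∣ (f x - f (x ^⊕ i)))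

  ^⊕-involutive : ∀ {n} (x : Vec Bool n) i → x ^⊕ i ^⊕ i ≡ x
  ^⊕-involutive (false ∷ x) zero    = ≡.refl
  ^⊕-involutive (true  ∷ x) zero    = ≡.refl
  ^⊕-involutive (b     ∷ x) (suc i) = ≡.cong (b ∷_) (^⊕-involutive x i)

  ^⊕-comm : ∀ {n} (x : Vec Bool n) i j → x ^⊕ i ^⊕ j ≡ x ^⊕ j ^⊕ i
  ^⊕-comm x i j with i ≟ j
  ... | yes ≡.refl = ≡.refl
  ... | no  i≢j    = updateAt-commutes j i (λ j≡i → i≢j (≡.sym j≡i)) x

  symmetrise-^⊕ : ∀ {n} (i : Fin n) (f : Vec Bool n → Carrier) x →
                 symmetrise i f (x ^⊕ i) ≈ symmetrise i f x
  symmetrise-^⊕ i f x =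
    trans (avg-cong refl (reflexive (≡.cong f (^⊕-involutive x i)))) (avg-comm _ _)

  -- By convexity of the absolute value the difference of the averages along j
  -- is at most the average of the differences at x and at x ^⊕ i, and these two
  -- have the same expectation.
  Inf-symmetrise : ∀ {n} (i j : Fin n) (f : Vec Bool n → Carrier) →
                   Inf j (symmetrise i f) ≤ Inf j f
  Inf-symmetrise i j f = begin
    Inf j (symmetrise i f)
      ≤⟨ 𝔼-mono (λ x → ∣avg-avg∣≤ (f x) (f (x ^⊕ i)) (f (x ^⊕ j)) (f (x ^⊕ j ^⊕ i))) ⟩
    𝔼 (λ x → avg (d x) ∣ f (x ^⊕ i) - f (x ^⊕ j ^⊕ i) ∣)
      ≈⟨ 𝔼-cong (λ x → reflexive (≡.cong (λ y → avg (d x) ∣ f (x ^⊕ i) - f y ∣) (^⊕-comm x j i))) ⟩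
    𝔼 (λ x → avg (d x) (d (x ^⊕ i)))
      ≈⟨ 𝔼-symmetrise i d ⟩
    Inf j f  ∎
    where
    d : Vec Bool _ → Carrier
    d x = ∣ f x - f (x ^⊕ j) ∣

  -- The value of a randomised tree

  -- The mean function computed node by node, with a fresh random bit at each
  -- stochastic node instead of a string of bits fixed in advance.
  value : ∀ {n} → Tree n → Vec Bool n → Carrier
  value (leaf a _ _)     x = a
  value (decision i s t) x = if lookup x i then value t x else value s x
  value (stochastic s t) x = avg (value s x) (value t x)

  -- Subtrees of a decision node share the bits of r, and a branch may use fewer
  -- bits than are supplied; stating this for every m at least the randomness
  -- complexity lets the induction pass through both.
  𝔼-evalWith : ∀ {n m} (t : Tree n) .(p : randomnessComplexity t ℕ.≤ m) x →
               𝔼 (evalWith t p x) ≈ value t x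
  𝔼-evalWith {m = m} (leaf a _ _) p x = 𝔼-const {m} a
  𝔼-evalWith {m = m} (decision i s t) p x with lookup x i
  ... | true  = 𝔼-evalWith {m = m} t _ x
  ... | false = 𝔼-evalWith {m = m} s _ x
  𝔼-evalWith {m = zero}  (stochastic s t) () x
  𝔼-evalWith {m = suc m} (stochastic s t) p x =
    trans (𝔼-∷ (evalWith (stochastic s t) p x)) 
          (avg-cong (𝔼-evalWith {m = m} s _ x) (𝔼-evalWith {m = m} t _ x))

  0≤value : ∀ {n} (t : Tree n) x → 0# ≤ value t x
  0≤value (leaf a 0≤a _)   x = 0≤a
  0≤value (decision i s t) x with lookup x i
  ... | true  = 0≤value t x
  ... | false = 0≤value s x
  0≤value (stochastic s t) x = ≤-respˡ-≈ (avg-idem 0#) (avg-mono (0≤value s x) (0≤value t x))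

  value≤1 : ∀ {n} (t : Tree n) x → value t x ≤ 1#
  value≤1 (leaf a _ a≤1)   x = a≤1
  value≤1 (decision i s t) x with lookup x i
  ... | true  = value≤1 t x
  ... | false = value≤1 s x
  value≤1 (stochastic s t) x = ≤-respʳ-≈ (avg-idem 1#) (avg-mono (value≤1 s x) (value≤1 t x))

  -- Replacing a query by a coin toss

  -- A tree may query the same variable again, so hard-wiring x_i has to reach
  -- every node on i for the value of the result not to depend on x_i.
  restrict : ∀ {n} → Fin n → Bool → Tree n → Tree n
  restrict i b (leaf a 0≤a a≤1) = leaf a 0≤a a≤1
  restrict i b (decision j s t) with j ≟ i
  ... | yes _ = if b then restrict i b t else restrict i b s
  ... | no  _ = decision j (restrict i b s) (restrict i b t)
  restrict i b (stochastic s t) = stochastic (restrict i b s) (restrict i b t)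

  value-restrict : ∀ {n} (i : Fin n) b (t : Tree n) x →
                   value (restrict i b t) x ≡ value t (x [ i ]≔ b)
  value-restrict i b (leaf a _ _) x = ≡.refl
  value-restrict i b (decision j s t) x with j ≟ i
  value-restrict i true  (decision i s t) x | yes ≡.refl
    rewrite lookup∘update i x true  = value-restrict i true t x
  value-restrict i false (decision i s t) x | yes ≡.refl
    rewrite lookup∘update i x false = value-restrict i false s x
  value-restrict i b     (decision j s t) x | no j≢i
    rewrite lookup∘update′ j≢i x b | value-restrict i b s x | value-restrict i b t x = ≡.refl
  value-restrict i b (stochastic s t) x =
    ≡.cong₂ avg (value-restrict i b s x) (value-restrict i b t x)

  queryComplexity-restrict : ∀ {n} (i : Fin n) b (t : Tree n) →
                             queryComplexity (restrict i b t) ℕ.≤ queryComplexity t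
  queryComplexity-restrict i b (leaf a _ _) = z≤n
  queryComplexity-restrict i b (decision j s t) with j ≟ i
  queryComplexity-restrict i true  (decision j s t) | yes _ =
    ℕₚ.m≤n⇒m≤1+n (ℕₚ.m≤n⇒m≤o⊔n (queryComplexity s) (queryComplexity-restrict i true t))
  queryComplexity-restrict i false (decision j s t) | yes _ =
    ℕₚ.m≤n⇒m≤1+n (ℕₚ.m≤n⇒m≤n⊔o (queryComplexity t) (queryComplexity-restrict i false s))
  queryComplexity-restrict i b     (decision j s t) | no _ =
    s≤s (ℕₚ.⊔-mono-≤ (queryComplexity-restrict i b s) (queryComplexity-restrict i b t))
  queryComplexity-restrict i b (stochastic s t) =
    ℕₚ.⊔-mono-≤ (queryComplexity-restrict i b s) (queryComplexity-restrict i b t)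

  -- The decision node on i with the query answered by a fair coin instead of by
  -- the input; later queries to i are answered consistently with the toss.
  randomise : ∀ {n} → Fin n → Tree n → Tree n → Tree n
  randomise i s t = stochastic (restrict i false s) (restrict i true t)

  avg-^⊕ : ∀ {n} (i : Fin n) (f : Vec Bool n → Carrier) x →
           symmetrise i f x ≈ avg (f (x [ i ]≔ false)) (f (x [ i ]≔ true))
  avg-^⊕ {n} i f x = by-bit (lookup x i) ≡.refl
    where
    x-unchanged : ∀ {b} → lookup x i ≡ b → f x ≈ f (x [ i ]≔ b)
    x-unchanged xᵢ≡b =
      reflexive (≡.cong f (≡.trans (≡.sym ([]≔-lookup x i)) (≡.cong (x [ i ]≔_) xᵢ≡b)))

    x-flipped : ∀ {b} → lookup x i ≡ b → f (x ^⊕ i) ≈ f (x [ i ]≔ not b)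
    x-flipped xᵢ≡b = reflexive (≡.cong f (updateAt-cong-local i x (≡.cong not xᵢ≡b)))

    by-bit : ∀ b → lookup x i ≡ b →
             symmetrise i f x ≈ avg (f (x [ i ]≔ false)) (f (x [ i ]≔ true))
    by-bit false xᵢ≡b = avg-cong (x-unchanged xᵢ≡b) (x-flipped xᵢ≡b)
    by-bit true  xᵢ≡b = trans (avg-cong (x-unchanged xᵢ≡b) (x-flipped xᵢ≡b)) (avg-comm _ _)

  avg-decision : ∀ {n} (i : Fin n) (s t : Tree n) x →
                 symmetrise i (value (decision i s t)) x ≈ value (randomise i s t) x
  avg-decision i s t x = begin-equality
    symmetrise i (value g) x                                  ≈⟨ avg-^⊕ i (value g) x ⟩
    avg (value g (x [ i ]≔ false)) (value g (x [ i ]≔ true))  ≡⟨ ≡.cong₂ avg on-false on-true ⟩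
    value (randomise i s t) x                               ∎
    where
    g : Tree _
    g = decision i s t

    on-false : value g (x [ i ]≔ false) ≡ value (restrict i false s) x
    on-false rewrite lookup∘update i x false = ≡.sym (value-restrict i false s x)

    on-true : value g (x [ i ]≔ true) ≡ value (restrict i true t) x
    on-true rewrite lookup∘update i x true = ≡.sym (value-restrict i true t x)

  -- A weight that ignores the i-th coordinate sees only the average of the
  -- tree over that coordinate, and cannot tell the query from a coin toss.
  𝔼-decision : ∀ {n} (i : Fin n) (s t : Tree n) (w : Vec Bool n → Carrier) →
               (∀ x → w (x ^⊕ i) ≈ w x) →
               𝔼 (λ x → w x * value (decision i s t) x) ≈
               𝔼 (λ x → w x * value (randomise i s t) x)
  𝔼-decision i s t w w-invariant = begin-equality
    𝔼 (λ x → w x * v x)                                        ≈⟨ 𝔼-symmetrise i (λ x → w x * v x) ⟨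
    𝔼 (λ x → avg (w x * v x) (w (x ^⊕ i) * v (x ^⊕ i)))        ≈⟨ 𝔼-cong (λ x → avg-cong refl (*-congʳ (w-invariant x))) ⟩
    𝔼 (λ x → avg (w x * v x) (w x * v (x ^⊕ i)))               ≈⟨ 𝔼-cong (λ x → avg-*ˡ (w x) (v x) (v (x ^⊕ i))) ⟩
    𝔼 (λ x → w x * avg (v x) (v (x ^⊕ i)))                     ≈⟨ 𝔼-cong (λ x → *-congˡ (avg-decision i s t x)) ⟩
    𝔼 (λ x → w x * value (randomise i s t) x)                ∎
    where
    v : Vec Bool _ → Carrier
    v = value (decision i s t)

  𝔼-value-decision : ∀ {n} (i : Fin n) (s t : Tree n) →
                     𝔼 (value (decision i s t)) ≈ 𝔼 (value (randomise i s t))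
  𝔼-value-decision {n} i s t = begin-equality
    𝔼 (value (decision i s t))                    ≈⟨ 𝔼-cong {n} (λ x → *-identityˡ _) ⟨
    𝔼 (λ x → 1# * value (decision i s t) x)       ≈⟨ 𝔼-decision i s t (λ _ → 1#) (λ _ → refl) ⟩
    𝔼 (λ x → 1# * value (randomise i s t) x)    ≈⟨ 𝔼-cong {n} (λ x → *-identityˡ _) ⟩
    𝔼 (value (randomise i s t))                 ∎

  -- Correlation with functions of small influence

  -- The induction is lexicographic in k and the tree: a stochastic node keeps k
  -- and passes to its subtrees, whereas a decision node lowers k and passes to
  -- the randomised tree, which is not a subtree.
  correlation-bound :
    ∀ {n M} → 0# ≤ M → ∀ k (t : Tree n) → queryComplexity t ℕ.≤ k →
    (f : Vec Bool n → Carrier) → (∀ j → Inf j f ≤ M) →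
    𝔼 (λ x → f x * value t x) ≤ 𝔼 f * 𝔼 (value t) + (k × 1#) * M
  correlation-bound {n} {M} 0≤M k (leaf a _ _) _ f _ = begin
    𝔼 (λ x → f x * a)                          ≈⟨ 𝔼-*ʳ f a ⟩
    𝔼 f * a                                    ≈⟨ *-congˡ (𝔼-const {n} a) ⟨
    𝔼 f * 𝔼 {n} (λ _ → a)                      ≤⟨ x≤x+y (*-nonNeg (0≤k k) 0≤M) ⟩
    𝔼 f * 𝔼 {n} (λ _ → a) + (k × 1#) * M       ∎
  correlation-bound {n} {M} 0≤M k (stochastic s t) p f Inf≤M = begin
    𝔼 (λ x → f x * avg (value s x) (value t x))
      ≈⟨ 𝔼-cong (λ x → avg-*ˡ (f x) (value s x) (value t x)) ⟨
    𝔼 (λ x → avg (f x * value s x) (f x * value t x))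
      ≈⟨ 𝔼-avg (λ x → f x * value s x) (λ x → f x * value t x) ⟩
    avg (𝔼 λ x → f x * value s x) (𝔼 λ x → f x * value t x)
      ≤⟨ avg-mono (correlation-bound 0≤M k s (ℕₚ.m⊔n≤o⇒m≤o _ _ p) f Inf≤M)
                  (correlation-bound 0≤M k t (ℕₚ.m⊔n≤o⇒n≤o _ _ p) f Inf≤M) ⟩
    avg (𝔼 f * 𝔼 (value s) + (k × 1#) * M) (𝔼 f * 𝔼 (value t) + (k × 1#) * M)
      ≈⟨ avg-+ _ _ _ _ ⟩
    avg (𝔼 f * 𝔼 (value s)) (𝔼 f * 𝔼 (value t)) + avg ((k × 1#) * M) ((k × 1#) * M)
      ≈⟨ +-cong (avg-*ˡ _ _ _) (avg-idem _) ⟩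
    𝔼 f * avg (𝔼 (value s)) (𝔼 (value t)) + (k × 1#) * M
      ≈⟨ +-congʳ (*-congˡ (𝔼-avg (value s) (value t))) ⟨
    𝔼 f * 𝔼 (value (stochastic s t)) + (k × 1#) * M  ∎
  correlation-bound {n} {M} 0≤M (suc k) (decision i s t) p f Inf≤M = begin
    𝔼 (λ x → f x * v x)
      ≤⟨ 𝔼-mono (λ x → *≤avg*+∣-∣ (f x) (f (x ^⊕ i)) (0≤value (decision i s t) x) (value≤1 (decision i s t) x)) ⟩
    𝔼 (λ x → f̄ x * v x + ∣ f x - f (x ^⊕ i) ∣)
      ≈⟨ 𝔼-+ (λ x → f̄ x * v x) (λ x → ∣ f x - f (x ^⊕ i) ∣) ⟩
    𝔼 (λ x → f̄ x * v x) + Inf i f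
      ≤⟨ +-monoʳ-≤ _ (Inf≤M i) ⟩
    𝔼 (λ x → f̄ x * v x) + M
      ≈⟨ +-congʳ (𝔼-decision i s t f̄ (symmetrise-^⊕ i f)) ⟩
    𝔼 (λ x → f̄ x * v̄ x) + M
      ≤⟨ +-monoˡ-≤ M (correlation-bound 0≤M k (randomise i s t) p̄ f̄ Inf̄≤M) ⟩
    𝔼 f̄ * 𝔼 v̄ + (k × 1#) * M + M
      ≈⟨ +-congʳ (+-congʳ (*-cong (𝔼-symmetrise i f) (sym (𝔼-value-decision i s t)))) ⟩
    𝔼 f * 𝔼 v + (k × 1#) * M + M
      ≈⟨ +-congˡ (*-identityˡ M) ⟨
    𝔼 f * 𝔼 v + (k × 1#) * M + 1# * M
      ≈⟨ solve 4 (λ a l o m → a :+ l :* m :+ o :* m := a :+ (o :+ l) :* m) refl (𝔼 f * 𝔼 v) (k × 1#) 1# M ⟩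
    𝔼 f * 𝔼 v + (suc k × 1#) * M  ∎
    where
    v v̄ f̄ : Vec Bool n → Carrier
    v = value (decision i s t)
    v̄ = value (randomise i s t)
    f̄ = symmetrise i f

    p̄ : queryComplexity (randomise i s t) ℕ.≤ k
    p̄ = ℕₚ.≤-trans (ℕₚ.⊔-mono-≤ (queryComplexity-restrict i false s) (queryComplexity-restrict i true t)) (s≤s⁻¹ p)

    Inf̄≤M : ∀ j → Inf j f̄ ≤ M
    Inf̄≤M j = ≤-trans (Inf-symmetrise i j f) (Inf≤M j)

  Var-mean-bound : ∀ {n M} → 0# ≤ M → ∀ k (R : Tree n) → queryComplexity R ℕ.≤ k →
                   (∀ j → Inf j (mean R) ≤ M) → Var (mean R) ≤ (k × 1#) * M
  Var-mean-bound {n} {M} 0≤M k R p Inf≤M = begin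
    Var μ                                            ≈⟨ Var-≈ μ ⟩
    𝔼 (λ x → μ x * μ x) - 𝔼 μ * 𝔼 μ                  ≈⟨ +-congʳ (𝔼-cong λ x → *-congˡ (μ≈value x)) ⟩
    𝔼 (λ x → μ x * value R x) - 𝔼 μ * 𝔼 μ            ≤⟨ +-monoˡ-≤ _ (correlation-bound 0≤M k R p μ Inf≤M) ⟩
    𝔼 μ * 𝔼 (value R) + (k × 1#) * M - 𝔼 μ * 𝔼 μ     ≈⟨ +-congʳ (+-congʳ (*-congˡ (𝔼-cong μ≈value))) ⟨
    𝔼 μ * 𝔼 μ + (k × 1#) * M - 𝔼 μ * 𝔼 μ             ≈⟨ xyx⁻¹≈y (𝔼 μ * 𝔼 μ) ((k × 1#) * M) ⟩
    (k × 1#) * M                                     ∎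
    where
    μ : Vec Bool n → Carrier
    μ = mean R

    μ≈value : ∀ x → μ x ≈ value R x
    μ≈value x = 𝔼-evalWith R ℕₚ.≤-refl x

lemma2p1 : ∀ {c ℓ₁ ℓ₂} (F : OrderedField c ℓ₁ ℓ₂) → let open DecisionTrees F in
    (n q : ℕ) .{{_ : NonZero n}} .{{_ : NonZero q}} →
    (R : Tree n) → queryComplexity R ℕ.≤ q →
    Σ[ i ∈ Fin n ] Var (mean R) / q ≤ Inf i (mean R)
lemma2p1 F (suc n) q R p =
  i , x≤ky⇒x/k≤y F q (Var-mean-bound F (Inf-nonNeg F i (mean R)) q R p Inf≤Infᵢ)
  where
  open DecisionTrees F
  open Extrema totalOrder using (argmax; f[xs]≤f[argmax])

  influence : Fin (suc n) → Carrier
  influence j = Inf j (mean R)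

  i : Fin (suc n)
  i = argmax influence zero (allFin (suc n))

  Inf≤Infᵢ : ∀ j → influence j ≤ influence i
  Inf≤Infᵢ j = All.lookup (f[xs]≤f[argmax] {f = influence} zero (allFin (suc n))) (∈-allFin j)
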